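{- Let $B(x)=\sum_{n\ge 0} b(n)x^n$ be a formal power series with $b(0)\neq 0$, let $B^{\Delta}(n,k)$ be the composita of $xB(x)$ (so in particular $B^{\Delta}(1,1)=b(0)$), and let $A(x)=1/B(x)$ be the reciprocal series, i.e. $A(x)B(x)=1$. Then the composita $A^{\Delta}(n,m)$ of $xA(x)$ is, for $n\ge m\ge 1$, $$A^{\Delta}(n,m)=\begin{cases}\dfrac{1}{B^{\Delta}(1,1)^m}, & n=m,\\[6pt] \dfrac{1}{B^{\Delta}(1,1)^m}\displaystyle\sum_{k=1}^{n-m}\binom{m+k-1}{m-1}\sum_{j=1}^{k}\frac{(-1)^j}{B^{\Delta}(1,1)^j}\binom{k}{j}B^{\Delta}(n-m+j,j), & n>m.\end{cases}$$
   Context: All generating functions are formal power series in $x$. For a power series $F(x)=\sum_{n\ge 1} f(n)x^n$ with zero constant term, its composita is the two-variable function $F^{\Delta}(n,k)$ ($n\ge k\ge 1$) defined by $F^{\Delta}(n,k)=\sum_{\lambda_1+\cdots+\lambda_k=n}f(\lambda_1)f(\lambda_2)\cdots f(\lambda_k)$, where the sum runs over all compositions of $n$ into exactly $k$ positive integer parts; equivalently $[F(x)]^k=\sum_{n\ge k}F^{\Delta}(n,k)x^n$. -}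

module Defs where

open import Algebra.Apartness.Bundles using (HeytingField; HeytingCommutativeRing)
open import Algebra.Bundles using (CommutativeRing)
import Algebra.Apartness.Properties.HeytingCommutativeRing as HeytingProperties
open import Data.Fin.Base using (toℕ)
open import Data.List.Base as List using (List; []; _∷_; concatMap; upTo)
open import Data.Nat.Base as ℕ using (ℕ; zero; suc; _∸_)
open import Data.Product.Base using (proj₁)
open import Data.Vec.Base as Vec using (Vec; []; _∷_)

-- All (λ₁ , … , λₖ) with every λᵢ ≥ 1 and λ₁ + ⋯ + λₖ = n, each listed once:
-- the first part suc i ranges over 1, …, n and the tail composes n ∸ suc i.
compositions : ℕ → (k : ℕ) → List (Vec ℕ k)
compositions zero    zero    = [] ∷ []
compositions (suc _) zero    = []
compositions n       (suc k) =
  concatMap (λ i → List.map (suc i ∷_) (compositions (n ∸ suc i) k)) (upTo n)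

-- In a Heyting field, x # 0# is the constructive form of x ≠ 0: it is
-- equivalent to invertibility of x, and its negation to x ≈ 0#.
module PowerSeries {c ℓ₁ ℓ₂} (K : HeytingField c ℓ₁ ℓ₂) where

  open HeytingField K
  open HeytingProperties heytingCommutativeRing using (1#0; x#0y#0→xy#0; #-congʳ)
  private
    module R = CommutativeRing (HeytingCommutativeRing.commutativeRing heytingCommutativeRing)

  open import Algebra.Properties.Monoid.Sum R.+-monoid using (sum-syntax; sum⁺-syntax)
  open import Algebra.Properties.Semiring.Exp R.semiring public using (_^_)
  open import Algebra.Properties.Monoid.Mult R.+-monoid public using () renaming (_×_ to _·_)

  infixl 7 _/_⟨_⟩
  -- #⇒invertible inverts y - 0#, which is ≈ y.
  _/_⟨_⟩ : Carrier → (y : Carrier) → y # 0# → Carrier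
  x / y ⟨ y#0 ⟩ = x * proj₁ (#⇒invertible y#0)

  infix 5 sum₁
  sum₁ : ℕ → (ℕ → Carrier) → Carrier
  sum₁ N f = ∑[ i < N ] f (suc (toℕ i))

  syntax sum₁ N (λ k → e) = ∑[1≤ k ≤ N ] e

  -- f represents Σₙ f(n) xⁿ.
  Series : Set c
  Series = ℕ → Carrier

  infix 4 _≋_
  _≋_ : Series → Series → Set ℓ₁
  f ≋ g = ∀ n → f n ≈ g n

  𝟙 : Series
  𝟙 zero    = 1#
  𝟙 (suc _) = 0#

  infixl 7 _⊛_
  _⊛_ : Series → Series → Series
  (f ⊛ g) n = ∑[ i ≤ n ] (f (toℕ i) * g (n ∸ toℕ i))

  -- x · f(x)
  shift : Series → Series
  shift f zero    = 0#
  shift f (suc n) = f n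

  composita : Series → ℕ → ℕ → Carrier
  composita f n k =
    List.foldr _+_ 0#
      (List.map (λ parts → Vec.foldr′ _*_ 1# (Vec.map f parts)) (compositions n k))

  composita-shift-1-1 : ∀ f → composita (shift f) 1 1 ≈ f 0
  composita-shift-1-1 f = trans (+-identityʳ _) (*-identityʳ _)

  composita-shift-1-1#0 : ∀ f → f 0 # 0# → composita (shift f) 1 1 # 0#
  composita-shift-1-1#0 f = #-congʳ (sym (composita-shift-1-1 f))

  ^-#0 : ∀ {x} → x # 0# → ∀ n → x ^ n # 0#
  ^-#0 x#0 zero    = 1#0
  ^-#0 x#0 (suc n) = x#0y#0→xy#0 x#0 (^-#0 x#0 n)

{-# OPTIONS --safe #-}
module Submission where

-- The composita of x F(x) at (n + k, k) is the coefficient of xⁿ in F(x)ᵏ, so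
-- the claim is a formula for the coefficients of Aᵐ. Put β = b(0) and
-- u = 1 - B/β. Then A = β⁻¹ (1 - u)⁻¹, hence Aᵐ = β⁻ᵐ Σₖ C(m+k-1, k) uᵏ. Since u
-- has zero constant term, only k ≤ n contribute to the coefficient of xⁿ, and
-- uᵏ is expanded in powers of B by the binomial theorem.

open import Defs
open import Algebra.Apartness.Bundles using (HeytingField; HeytingCommutativeRing)
open import Algebra.Bundles using (CommutativeRing; CommutativeSemiring)
import Algebra.Apartness.Properties.HeytingCommutativeRing as HeytingProperties
import Algebra.Properties.CommutativeSemigroup as CommutativeSemigroupProperties
import Algebra.Properties.CommutativeSemiring.Binomial as Binomial
import Algebra.Properties.CommutativeSemiring.Exp as Exp
import Algebra.Properties.Ring as RingProperties
import Algebra.Properties.Semiring.Mult as Mult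
import Algebra.Properties.Semiring.Sum as Sum
open import Data.Fin.Base using (Fin; zero; suc; toℕ)
open import Data.List.Base as List using (List; []; _∷_; _++_; concatMap; applyUpTo; upTo)
open import Data.List.Properties using (map-++)
open import Data.Nat.Base as ℕ using (ℕ; zero; suc; _∸_; _≤_; _<_; z≤n; s≤s⁻¹)
open import Data.Nat.Combinatorics using (_C_; nCn≡1; nCk≡nC[n∸k]; k>n⇒nCk≡0; nCk+nC[k+1]≡[n+1]C[k+1])
import Data.Nat.Properties as ℕ
open import Data.Product.Base using (_×_; ∃-syntax; _,_; proj₁; proj₂)
open import Data.Vec.Base as Vec using (Vec; _∷_)
open import Function.Base using (_∘_)
open import Relation.Binary.PropositionalEquality.Core as ≡ using (_≡_)
import Relation.Binary.Reasoning.Setoid as SetoidReasoning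

-- Binomial coefficients and multiset counts.

nC0≡1 : ∀ n → n C 0 ≡ 1
nC0≡1 n = ≡.trans (nCk≡nC[n∸k] {0} {n} z≤n) (nCn≡1 n)

-- The expansion of a negative power produces the lower index `k`, whereas the formula to be proved
-- has the lower index `m`; symmetry of Pascal's triangle connects the two.
[m+k]Cm≡[m+k]Ck : ∀ m k → (m ℕ.+ k) C m ≡ (m ℕ.+ k) C k
[m+k]Cm≡[m+k]Ck m k =
  ≡.trans (nCk≡nC[n∸k] (ℕ.m≤m+n m k)) (≡.cong ((m ℕ.+ k) C_) (ℕ.m+n∸m≡n m k))

-- The number of multisets of size k from m elements. The junk value 0 ∸ 1 = 0
-- is harmless: the value is 1 at m = k = 0 as it should be.
multichoose : ℕ → ℕ → ℕ
multichoose m k = (m ℕ.+ k ∸ 1) C k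

-- Pascal's rule in multiset form. It is the coefficientwise shadow of
-- `p ^ suc m ≈ p ^ m + u * p ^ suc m` for `p` = 1/(1 - `u`).
multichoose-suc-suc : ∀ m k →
  multichoose (suc m) (suc k) ≡ multichoose m (suc k) ℕ.+ multichoose (suc m) k
multichoose-suc-suc m k
  rewrite ℕ.+-suc m k
  = ≡.trans (≡.sym (nCk+nC[k+1]≡[n+1]C[k+1] (m ℕ.+ k) k))
            (ℕ.+-comm ((m ℕ.+ k) C k) _)

-- The negative binomial series with remainder.

module NegativeBinomial {c ℓ} (S : CommutativeSemiring c ℓ) where

  open CommutativeSemiring S hiding (zero)
  open Exp S
  open Mult semiring using (×-comm-*; ×-homo-+; ×-congˡ) renaming (_×_ to _·_)
  open Sum semiring
  open CommutativeSemigroupProperties +-commutativeSemigroup using (interchange)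
  open SetoidReasoning setoid

  -- The truncation of the expansion of (1 - `u`)⁻ᵐ to powers of `u` below `N`.
  partialSum : Carrier → ℕ → ℕ → Carrier
  partialSum u m N = ∑[ k < N ] (multichoose m (toℕ k) · u ^ toℕ k)

  private
    -- The constant term is split off because Pascal's rule applies only to positive exponents.
    tailSum : Carrier → ℕ → ℕ → Carrier
    tailSum u m N = ∑[ k < N ] (multichoose m (suc (toℕ k)) · u ^ suc (toℕ k))

    tailSum-zero : ∀ u N → tailSum u 0 N ≈ 0#
    tailSum-zero u N = trans
      (sum-cong-≋ {N} (λ k → ×-congˡ {u ^ suc (toℕ k)} (k>n⇒nCk≡0 (ℕ.n<1+n (toℕ k)))))
      (sum-replicate-zero N)

    head-partialSum : ∀ u m N → partialSum u m (suc N) ≈ 1# + tailSum u m N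
    head-partialSum u m N =
      +-congʳ (trans (×-congˡ (nC0≡1 (m ℕ.+ 0 ∸ 1))) (+-identityʳ 1#))

    -- Pascal's rule splits every coefficient in two. In the second half each power of `u` is one
    -- higher than the index of its coefficient, so one factor `u` comes out.
    tailSum-suc : ∀ u m N →
      tailSum u (suc m) N ≈ tailSum u m N + u * partialSum u (suc m) N
    tailSum-suc u m N = begin
      tailSum u (suc m) N
        ≈⟨ sum-cong-≋ {N} (λ k → trans
             (×-congˡ (multichoose-suc-suc m (toℕ k)))
             (×-homo-+ _ (multichoose m (suc (toℕ k))) _)) ⟩
      ∑[ k < N ] (multichoose m (suc (toℕ k)) · u ^ suc (toℕ k)
                  + multichoose (suc m) (toℕ k) · u ^ suc (toℕ k))
        ≈⟨ ∑-distrib-+ {N} _ _ ⟩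
      tailSum u m N + ∑[ k < N ] (multichoose (suc m) (toℕ k) · u ^ suc (toℕ k))
        ≈⟨ +-congˡ (sum-cong-≋ {N} (λ k → ×-comm-* (multichoose (suc m) (toℕ k)) u _)) ⟨
      tailSum u m N + ∑[ k < N ] (u * (multichoose (suc m) (toℕ k) · u ^ toℕ k))
        ≈⟨ +-congˡ (*-distribˡ-sum {N} u _) ⟨
      tailSum u m N + u * partialSum u (suc m) N ∎

  -- The hypothesis says p (1 - u) = 1 without subtraction.
  expansion : ∀ {p u} → p ≈ 1# + u * p → ∀ m N →
              ∃[ q ] p ^ m ≈ partialSum u m N + u ^ N * q
  expansion {p} {u} p≈1+up m zero =
    p ^ m , sym (trans (+-identityˡ _) (*-identityˡ _))
  -- For exponent 0 every term beyond the constant vanishes, so the truncation is exact and the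
  -- remainder is zero.
  expansion {p} {u} p≈1+up zero (suc N) = 0# , sym (begin
    partialSum u 0 (suc N) + u ^ suc N * 0#
      ≈⟨ +-cong (trans (head-partialSum u 0 N) (+-congˡ (tailSum-zero u N))) (zeroʳ _) ⟩
    1# + 0# + 0#
      ≈⟨ trans (+-identityʳ _) (+-identityʳ _) ⟩
    1# ∎)
  expansion {p} {u} p≈1+up (suc m) (suc N)
    -- Expanding one factor gives `p ^ suc m ≈ p ^ m + u * p ^ suc m`. The second summand carries an
    -- extra `u`, so its expansion is needed only to order `N`; this makes the recursion on both
    -- arguments terminate.
    with expansion p≈1+up m (suc N) | expansion p≈1+up (suc m) N
  ... | q₁ , eq₁ | q₂ , eq₂ = q₁ + q₂ , (begin
    p * p ^ m
      ≈⟨ *-congʳ p≈1+up ⟩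
    (1# + u * p) * p ^ m
      ≈⟨ trans (distribʳ _ _ _) (+-cong (*-identityˡ _) (*-assoc _ _ _)) ⟩
    p ^ m + u * p ^ suc m
      ≈⟨ +-cong eq₁ (*-congˡ eq₂) ⟩
    (partialSum u m (suc N) + u ^ suc N * q₁) + u * (partialSum u (suc m) N + u ^ N * q₂)
      ≈⟨ +-congˡ (trans (distribˡ _ _ _) (+-congˡ (sym (*-assoc _ _ _)))) ⟩
    (partialSum u m (suc N) + u ^ suc N * q₁) + (u * partialSum u (suc m) N + u ^ suc N * q₂)
      ≈⟨ interchange _ _ _ _ ⟩
    (partialSum u m (suc N) + u * partialSum u (suc m) N) + (u ^ suc N * q₁ + u ^ suc N * q₂)
      ≈⟨ +-cong partialSum-suc (sym (distribˡ _ _ _)) ⟩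
    partialSum u (suc m) (suc N) + u ^ suc N * (q₁ + q₂) ∎)
    where
    partialSum-suc : partialSum u m (suc N) + u * partialSum u (suc m) N
                     ≈ partialSum u (suc m) (suc N)
    partialSum-suc = begin
      partialSum u m (suc N) + u * partialSum u (suc m) N
        ≈⟨ +-congʳ (head-partialSum u m N) ⟩
      1# + tailSum u m N + u * partialSum u (suc m) N
        ≈⟨ +-assoc _ _ _ ⟩
      1# + (tailSum u m N + u * partialSum u (suc m) N)
        ≈⟨ +-congˡ (tailSum-suc u m N) ⟨
      1# + tailSum u (suc m) N
        ≈⟨ head-partialSum u (suc m) N ⟨
      partialSum u (suc m) (suc N) ∎

-- The earlier clauses of `compositions` split on `n`, so its last clause does not compute while `n`
-- is a variable.
compositions-suc : ∀ n k → compositions n (suc k)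
  ≡ concatMap (λ i → List.map (suc i ∷_) (compositions (n ∸ suc i) k)) (upTo n)
compositions-suc zero    k = ≡.refl
compositions-suc (suc n) k = ≡.refl

module SeriesProperties {c ℓ₁ ℓ₂} (K : HeytingField c ℓ₁ ℓ₂) where

  open HeytingField K using (heytingCommutativeRing; _#_; #⇒invertible)
  open PowerSeries K
  private
    ring : CommutativeRing c ℓ₁
    ring = HeytingCommutativeRing.commutativeRing heytingCommutativeRing
  open CommutativeRing ring hiding (ring; zero)
  open RingProperties (CommutativeRing.ring ring) using (-‿distribˡ-*; -1*x≈-x)
  open HeytingProperties heytingCommutativeRing using (x-0≈x)
  open Exp commutativeSemiring using (^-congˡ; ^-distrib-*)
  open Mult semiring using (×-congʳ; ×-congˡ; ×-comm-*)
  open Sum semiring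
  open SetoidReasoning setoid

  -- Formal power series as a commutative ring.

  infixr 8 _◃_
  _◃_ : Carrier → Series → Series
  (s ◃ f) n = s * f n

  infixl 6 _⊞_
  _⊞_ : Series → Series → Series
  (f ⊞ g) n = f n + g n

  ⊛-cong : ∀ {f f′ g g′} → f ≋ f′ → g ≋ g′ → f ⊛ g ≋ f′ ⊛ g′
  ⊛-cong f≋f′ g≋g′ n =
    sum-cong-≋ {suc n} (λ i → *-cong (f≋f′ (toℕ i)) (g≋g′ (n ∸ toℕ i)))

  ⊛-congˡ : ∀ f {g g′} → g ≋ g′ → f ⊛ g ≋ f ⊛ g′
  ⊛-congˡ f g≋g′ = ⊛-cong {f} (λ _ → refl) g≋g′

  ⊛-distribʳ-⊞ : ∀ h f g → (f ⊞ g) ⊛ h ≋ f ⊛ h ⊞ g ⊛ h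
  ⊛-distribʳ-⊞ h f g n =
    trans (sum-cong-≋ {suc n} (λ i → distribʳ (h (n ∸ toℕ i)) (f (toℕ i)) (g (toℕ i))))
          (∑-distrib-+ {suc n} (λ i → f (toℕ i) * h (n ∸ toℕ i)) (λ i → g (toℕ i) * h (n ∸ toℕ i)))

  ◃-⊛ˡ : ∀ s f g → (s ◃ f) ⊛ g ≋ s ◃ (f ⊛ g)
  ◃-⊛ˡ s f g n =
    trans (sum-cong-≋ {suc n} (λ i → *-assoc s (f (toℕ i)) (g (n ∸ toℕ i))))
          (sym (*-distribˡ-sum {suc n} s (λ i → f (toℕ i) * g (n ∸ toℕ i))))

  -- By definition the Cauchy product peels off the constant coefficient of its left factor. This
  -- mirror image peels off that of the right factor, so commutativity follows by induction without
  -- reindexing any sum.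
  ⊛-expandʳ : ∀ f g n → (f ⊛ g) (suc n) ≈ f (suc n) * g 0 + (f ⊛ (g ∘ suc)) n
  ⊛-expandʳ f g zero = begin
    f 0 * g 1 + (f 1 * g 0 + 0#)  ≈⟨ +-congˡ (+-identityʳ _) ⟩
    f 0 * g 1 + f 1 * g 0         ≈⟨ +-comm _ _ ⟩
    f 1 * g 0 + f 0 * g 1         ≈⟨ +-congˡ (+-identityʳ _) ⟨
    f 1 * g 0 + (f 0 * g 1 + 0#)  ∎
  ⊛-expandʳ f g (suc n) = begin
    f 0 * g (2 ℕ.+ n) + ((f ∘ suc) ⊛ g) (suc n)
      ≈⟨ +-congˡ (⊛-expandʳ (f ∘ suc) g n) ⟩
    f 0 * g (2 ℕ.+ n) + (f (2 ℕ.+ n) * g 0 + ((f ∘ suc) ⊛ (g ∘ suc)) n)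
      ≈⟨ +-assoc _ _ _ ⟨
    f 0 * g (2 ℕ.+ n) + f (2 ℕ.+ n) * g 0 + ((f ∘ suc) ⊛ (g ∘ suc)) n
      ≈⟨ +-congʳ (+-comm _ _) ⟩
    f (2 ℕ.+ n) * g 0 + f 0 * g (2 ℕ.+ n) + ((f ∘ suc) ⊛ (g ∘ suc)) n
      ≈⟨ +-assoc _ _ _ ⟩
    f (2 ℕ.+ n) * g 0 + (f ⊛ (g ∘ suc)) (suc n) ∎

  ⊛-comm : ∀ f g → f ⊛ g ≋ g ⊛ f
  ⊛-comm f g zero    = +-congʳ (*-comm _ _)
  ⊛-comm f g (suc n) =
    trans (+-cong (*-comm _ _) (⊛-comm (f ∘ suc) g n)) (sym (⊛-expandʳ g f n))

  ⊛-assoc : ∀ f g h → (f ⊛ g) ⊛ h ≋ f ⊛ (g ⊛ h)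
  ⊛-assoc f g h zero = +-congʳ (begin
    (f 0 * g 0 + 0#) * h 0   ≈⟨ *-congʳ (+-identityʳ _) ⟩
    f 0 * g 0 * h 0          ≈⟨ *-assoc _ _ _ ⟩
    f 0 * (g 0 * h 0)        ≈⟨ *-congˡ (+-identityʳ _) ⟨
    f 0 * (g 0 * h 0 + 0#)   ∎)
  ⊛-assoc f g h (suc n) = begin
    -- The tail of `f ⊛ g` is definitionally `f 0 ◃ (g ∘ suc) ⊞ (f ∘ suc) ⊛ g`, which brings the
    -- induction hypothesis for `f ∘ suc` into play.
    (f 0 * g 0 + 0#) * h (suc n) + ((f 0 ◃ (g ∘ suc) ⊞ (f ∘ suc) ⊛ g) ⊛ h) n
      ≈⟨ +-cong (trans (*-congʳ (+-identityʳ _)) (*-assoc _ _ _))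
                (⊛-distribʳ-⊞ h (f 0 ◃ (g ∘ suc)) ((f ∘ suc) ⊛ g) n) ⟩
    f 0 * (g 0 * h (suc n)) + (((f 0 ◃ (g ∘ suc)) ⊛ h) n + (((f ∘ suc) ⊛ g) ⊛ h) n)
      ≈⟨ +-congˡ (+-cong (◃-⊛ˡ (f 0) (g ∘ suc) h n) (⊛-assoc (f ∘ suc) g h n)) ⟩
    f 0 * (g 0 * h (suc n)) + (f 0 * ((g ∘ suc) ⊛ h) n + ((f ∘ suc) ⊛ (g ⊛ h)) n)
      ≈⟨ +-assoc _ _ _ ⟨
    f 0 * (g 0 * h (suc n)) + f 0 * ((g ∘ suc) ⊛ h) n + ((f ∘ suc) ⊛ (g ⊛ h)) n
      ≈⟨ +-congʳ (distribˡ _ _ _) ⟨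
    (f ⊛ (g ⊛ h)) (suc n) ∎

  ⊛-zeroˡ : ∀ f n → ((λ _ → 0#) ⊛ f) n ≈ 0#
  ⊛-zeroˡ f n = trans (sum-cong-≋ {suc n} (λ i → zeroˡ (f (n ∸ toℕ i)))) (sum-replicate-zero (suc n))

  ⊛-identityˡ : ∀ f → 𝟙 ⊛ f ≋ f
  ⊛-identityˡ f zero    = trans (+-identityʳ _) (*-identityˡ _)
  ⊛-identityˡ f (suc n) =
    trans (+-cong (*-identityˡ _) (⊛-zeroˡ f n)) (+-identityʳ _)

  -- With this instance, powers, the binomial theorem and `NegativeBinomial` all apply to series
  -- themselves.
  seriesRing : CommutativeRing c ℓ₁
  seriesRing = record
    { Carrier = Series
    ; _≈_     = _≋_
    ; _+_     = _⊞_
    ; _*_     = _⊛_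
    ; -_      = λ f n → - f n
    ; 0#      = λ _ → 0#
    ; 1#      = 𝟙
    ; isCommutativeRing = record
      { isRing = record
        { +-isAbelianGroup = record
          { isGroup = record
            { isMonoid = record
              { isSemigroup = record
                { isMagma = record
                  { isEquivalence = record
                    { refl  = λ n → refl
                    ; sym   = λ f≋g n → sym (f≋g n)
                    ; trans = λ f≋g g≋h n → trans (f≋g n) (g≋h n)
                    }
                  ; ∙-cong = λ f≋f′ g≋g′ n → +-cong (f≋f′ n) (g≋g′ n)
                  }
                ; assoc = λ f g h n → +-assoc (f n) (g n) (h n)
                }
              ; identity = (λ f n → +-identityˡ (f n)) , (λ f n → +-identityʳ (f n))
              }
            ; inverse = (λ f n → -‿inverseˡ (f n)) , (λ f n → -‿inverseʳ (f n))
            ; ⁻¹-cong = λ f≋g n → -‿cong (f≋g n)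
            }
          ; comm = λ f g n → +-comm (f n) (g n)
          }
        ; *-cong     = ⊛-cong
        ; *-assoc    = ⊛-assoc
        ; *-identity = ⊛-identityˡ , λ f n → trans (⊛-comm f 𝟙 n) (⊛-identityˡ f n)
        ; distrib    = (λ h f g n → trans (⊛-comm h (f ⊞ g) n)
                         (trans (⊛-distribʳ-⊞ h f g n)
                                (+-cong (⊛-comm f h n) (⊛-comm g h n))))
                     , ⊛-distribʳ-⊞
        }
      ; *-comm = ⊛-comm
      }
    }

  private
    module 𝕊 where
      open CommutativeRing seriesRing public
      open Exp (CommutativeRing.commutativeSemiring seriesRing) public
      open Sum (CommutativeRing.semiring seriesRing) public using (sum)
      open Mult (CommutativeRing.semiring seriesRing) public using () renaming (_×_ to _·_)
      open NegativeBinomial (CommutativeRing.commutativeSemiring seriesRing) public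
      open Binomial (CommutativeRing.commutativeSemiring seriesRing) public
        using (theorem; binomialTerm)

  -- Powers of series and their coefficients.

  infixr 8 _^ˢ_
  _^ˢ_ : Series → ℕ → Series
  _^ˢ_ = 𝕊._^_

  ◃-⊛ʳ : ∀ s f g → f ⊛ (s ◃ g) ≋ s ◃ (f ⊛ g)
  ◃-⊛ʳ s f g n =
    trans (⊛-comm f (s ◃ g) n) (trans (◃-⊛ˡ s g f n) (*-congˡ (⊛-comm g f n)))

  ◃-⊛-◃ : ∀ s f t g → (s ◃ f) ⊛ (t ◃ g) ≋ (s * t) ◃ (f ⊛ g)
  ◃-⊛-◃ s f t g n = trans (◃-⊛ˡ s f (t ◃ g) n)
    (trans (*-congˡ (◃-⊛ʳ t f g n)) (sym (*-assoc _ _ _)))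

  ◃-^ : ∀ s f j → (s ◃ f) ^ˢ j ≋ (s ^ j) ◃ (f ^ˢ j)
  ◃-^ s f zero    n = sym (*-identityˡ _)
  ◃-^ s f (suc j) n =
    trans (⊛-congˡ (s ◃ f) (◃-^ s f j) n) (◃-⊛-◃ s f (s ^ j) (f ^ˢ j) n)

  ^-constant : ∀ f m → (f ^ˢ m) 0 ≈ f 0 ^ m
  ^-constant f zero    = refl
  ^-constant f (suc m) = trans (+-identityʳ _) (*-congˡ (^-constant f m))

  sum-coefficient : ∀ {k} (t : Fin k → Series) n → 𝕊.sum t n ≡ ∑[ i < k ] t i n
  sum-coefficient {zero}  t n = ≡.refl
  sum-coefficient {suc k} t n = ≡.cong (t zero n +_) (sum-coefficient (t ∘ suc) n)

  ·-coefficient : ∀ k f n → (k 𝕊.· f) n ≡ k · f n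
  ·-coefficient zero    f n = ≡.refl
  ·-coefficient (suc k) f n = ≡.cong (f n +_) (·-coefficient k f n)

  -- Each factor `u` raises the order by at least one: as `u 0` vanishes, a coefficient of `u ⊛ g`
  -- involves only strictly earlier coefficients of `g`. This disposes of the remainder in
  -- `expansion`.
  ^-order : ∀ {u} → u 0 ≈ 0# → ∀ N q {n} → n < N → (u ^ˢ N ⊛ q) n ≈ 0#
  ^-order {u} u₀≈0 (suc N) q {n} n<1+N =
    trans (⊛-assoc u (u ^ˢ N) q n) (vanish n (s≤s⁻¹ n<1+N))
    where
    g : Series
    g = u ^ˢ N ⊛ q

    vanish : ∀ n → n ≤ N → (u ⊛ g) n ≈ 0#
    vanish zero    _   = trans (+-identityʳ _) (trans (*-congʳ u₀≈0) (zeroˡ _))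
    vanish (suc n) n<N = begin
      u 0 * g (suc n) + ∑[ i < suc n ] (u (suc (toℕ i)) * g (n ∸ toℕ i))
        ≈⟨ +-cong (trans (*-congʳ u₀≈0) (zeroˡ _))
             (sum-cong-≋ {suc n} (λ i → trans
               (*-congˡ {u (suc (toℕ i))} (^-order {u} u₀≈0 N q (ℕ.≤-<-trans (ℕ.m∸n≤m n (toℕ i)) n<N)))
               (zeroʳ (u (suc (toℕ i)))))) ⟩
      0# + ∑[ i < suc n ] 0#
        ≈⟨ trans (+-identityˡ _) (sum-replicate-zero (suc n)) ⟩
      0# ∎

  -- Compositae as coefficients of powers.

  shift^ : ℕ → Series → Series
  shift^ zero    f = f
  shift^ (suc k) f = shift (shift^ k f)

  shift^-+ : ∀ k f n → shift^ k f (n ℕ.+ k) ≡ f n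
  shift^-+ zero    f n rewrite ℕ.+-identityʳ n = ≡.refl
  shift^-+ (suc k) f n rewrite ℕ.+-suc n k     = shift^-+ k f n

  shift-cong : ∀ {f g} → f ≋ g → shift f ≋ shift g
  shift-cong f≋g zero    = refl
  shift-cong f≋g (suc n) = f≋g n

  -- Peeling off the right constant coefficient suffices, since that of `shift g` is zero and its
  -- tail is `g`.
  ⊛-shift : ∀ f g → f ⊛ shift g ≋ shift (f ⊛ g)
  ⊛-shift f g zero    = trans (+-identityʳ _) (zeroʳ _)
  ⊛-shift f g (suc n) = trans (⊛-expandʳ f (shift g) n) (trans (+-congʳ (zeroʳ _)) (+-identityˡ _))

  ⊛-shift^ : ∀ k f g → f ⊛ shift^ k g ≋ shift^ k (f ⊛ g)
  ⊛-shift^ zero    f g n = refl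
  ⊛-shift^ (suc k) f g n =
    trans (⊛-shift f (shift^ k g) n) (shift-cong (⊛-shift^ k f g) n)

  private
    weight : ∀ {k} → Series → Vec ℕ k → Carrier
    weight f parts = Vec.foldr′ _*_ 1# (Vec.map f parts)

    total : List Carrier → Carrier
    total = List.foldr _+_ 0#

    total-++ : ∀ xs ys → total (xs ++ ys) ≈ total xs + total ys
    total-++ []       ys = sym (+-identityˡ _)
    total-++ (x ∷ xs) ys = trans (+-congˡ (total-++ xs ys)) (sym (+-assoc _ _ _))

    total-prepend : ∀ {k} f i (ps : List (Vec ℕ k)) →
      total (List.map (weight f) (List.map (i ∷_) ps)) ≈ f i * total (List.map (weight f) ps)
    total-prepend f i []       = sym (zeroʳ _)
    total-prepend f i (p ∷ ps) = trans (+-congˡ (total-prepend f i ps)) (sym (distribˡ _ _ _))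

    -- The enumeration `g` is arbitrary because the recursion of `applyUpTo` replaces it by
    -- `g ∘ suc`; `upTo` is the case of the identity.
    total-concatMap : ∀ {k} f (h : ℕ → List (Vec ℕ k)) (g : ℕ → ℕ) n →
      total (List.map (weight f) (concatMap h (applyUpTo g n)))
        ≈ ∑[ i < n ] total (List.map (weight f) (h (g (toℕ i))))
    total-concatMap f h g zero    = refl
    total-concatMap f h g (suc n)
      rewrite map-++ (weight f) (h (g 0)) (concatMap h (applyUpTo (g ∘ suc) n))
      = trans (total-++ (List.map (weight f) (h (g 0))) _)
              (+-congˡ (total-concatMap f h (g ∘ suc) n))

  composita-suc : ∀ f n k →
    composita f n (suc k) ≈ ∑[ i < n ] (f (suc (toℕ i)) * composita f (n ∸ suc (toℕ i)) k)
  composita-suc f n k rewrite compositions-suc n k = trans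
    (total-concatMap f (λ i → List.map (suc i ∷_) (compositions (n ∸ suc i) k)) (λ i → i) n)
    (sum-cong-≋ {n} (λ i → total-prepend f (suc (toℕ i)) (compositions (n ∸ suc (toℕ i)) k)))

  -- Phrasing the power through `shift^` covers `n < k` as well, where both sides vanish, so the
  -- induction on `k` needs no side condition.
  composita-shift : ∀ f k n → composita (shift f) n k ≈ shift^ k (f ^ˢ k) n
  composita-shift f zero    zero    = +-identityʳ _
  composita-shift f zero    (suc n) = refl
  composita-shift f (suc k) zero    = composita-suc (shift f) 0 k
  composita-shift f (suc k) (suc n) = begin
    composita (shift f) (suc n) (suc k)
      ≈⟨ composita-suc (shift f) (suc n) k ⟩
    -- A first part `suc i` has weight `f i` and leaves `n ∸ i`, so the sum over first parts is
    -- already a Cauchy product.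
    (f ⊛ (λ i → composita (shift f) i k)) n
      ≈⟨ ⊛-congˡ f (composita-shift f k) n ⟩
    (f ⊛ shift^ k (f ^ˢ k)) n
      ≈⟨ ⊛-shift^ k f (f ^ˢ k) n ⟩
    shift^ k (f ^ˢ suc k) n ∎

  composita-coefficient : ∀ f n k → composita (shift f) (n ℕ.+ k) k ≈ (f ^ˢ k) n
  composita-coefficient f n k =
    trans (composita-shift f k (n ℕ.+ k)) (reflexive (shift^-+ k (f ^ˢ k) n))

  -- Division, and powers of the reciprocal series.

  -- Inverses are unique, so a quotient can be computed with any known inverse `z` in place of the
  -- one extracted from the apartness proof.
  /-unique : ∀ {y z} x (y#0 : y # 0#) → z * y ≈ 1# → x / y ⟨ y#0 ⟩ ≈ x * z
  /-unique {y} {z} x y#0 zy≈1 = *-congˡ (begin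
    y⁻¹                ≈⟨ *-identityˡ _ ⟨
    1# * y⁻¹           ≈⟨ *-congʳ zy≈1 ⟨
    z * y * y⁻¹        ≈⟨ *-assoc _ _ _ ⟩
    z * (y * y⁻¹)      ≈⟨ *-congˡ (*-congʳ (x-0≈x y)) ⟨
    z * ((y - 0#) * y⁻¹) ≈⟨ *-congˡ (proj₂ (proj₂ (#⇒invertible y#0))) ⟩
    z * 1#             ≈⟨ *-identityʳ _ ⟩
    z                  ∎)
    where
    y⁻¹ : Carrier
    y⁻¹ = proj₁ (#⇒invertible y#0)

  module Reciprocal (b a : Series) (b₀#0 : b 0 # 0#) (ab≋1 : a ⊛ b ≋ 𝟙) where

    α β : Carrier
    α = a 0
    β = b 0

    αβ≈1 : α * β ≈ 1#
    αβ≈1 = trans (sym (+-identityʳ _)) (ab≋1 0)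

    -- Since `α` is the inverse of `β`, `u` is 1 - B/β, written as a sum so that the binomial
    -- theorem applies directly, and `p` is 1/(1 - `u`).
    p u : Series
    p = β ◃ a
    u = (- α) ◃ b ⊞ 𝟙

    u₀≈0 : u 0 ≈ 0#
    u₀≈0 = trans (+-congʳ (trans (sym (-‿distribˡ-* α β)) (-‿cong αβ≈1))) (-‿inverseˡ 1#)

    -- Multiplying out, `u ⊛ p` is `p` minus `α * β` times `b ⊛ a`, that is, `p` minus `𝟙`.
    p≋1+up : p ≋ 𝟙 ⊞ u ⊛ p
    p≋1+up n = sym (begin
      𝟙 n + (((- α) ◃ b ⊞ 𝟙) ⊛ p) n
        ≈⟨ +-congˡ (⊛-distribʳ-⊞ p ((- α) ◃ b) 𝟙 n) ⟩
      𝟙 n + ((((- α) ◃ b) ⊛ p) n + (𝟙 ⊛ p) n)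
        ≈⟨ +-congˡ (+-cong (◃-⊛-◃ (- α) b β a n) (⊛-identityˡ p n)) ⟩
      𝟙 n + (- α * β * (b ⊛ a) n + p n)
        ≈⟨ +-congˡ (+-congʳ (*-cong
             (trans (sym (-‿distribˡ-* α β)) (-‿cong αβ≈1))
             (trans (⊛-comm b a n) (ab≋1 n)))) ⟩
      𝟙 n + (- 1# * 𝟙 n + p n)
        ≈⟨ +-assoc _ _ _ ⟨
      𝟙 n + - 1# * 𝟙 n + p n
        ≈⟨ +-congʳ (trans (+-congˡ (-1*x≈-x (𝟙 n))) (-‿inverseʳ (𝟙 n))) ⟩
      0# + p n
        ≈⟨ +-identityˡ _ ⟩
      p n ∎)

    a≋αp : a ≋ α ◃ p
    a≋αp n = sym (trans (sym (*-assoc _ _ _)) (trans (*-congʳ αβ≈1) (*-identityˡ _)))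

    BΔ : ℕ → ℕ → Carrier
    BΔ = composita (shift b)

    β#0 : BΔ 1 1 # 0#
    β#0 = composita-shift-1-1#0 b b₀#0

    -- Every division in the formula becomes multiplication by a power of `α`.
    /β^ : ∀ x j → x / BΔ 1 1 ^ j ⟨ ^-#0 β#0 j ⟩ ≈ x * α ^ j
    /β^ x j = /-unique x (^-#0 β#0 j) (begin
      α ^ j * BΔ 1 1 ^ j   ≈⟨ ^-distrib-* α (BΔ 1 1) j ⟨
      (α * BΔ 1 1) ^ j     ≈⟨ ^-congˡ j (trans (*-congˡ (composita-shift-1-1 b)) αβ≈1) ⟩
      1# ^ j               ≈⟨ 1^ j ⟩
      1#                   ∎)
      where
      1^ : ∀ j → 1# ^ j ≈ 1#
      1^ zero    = refl
      1^ (suc j) = trans (*-identityˡ _) (1^ j)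

    negate^ : ∀ j → (- α) ^ j ≈ (- 1#) ^ j * α ^ j
    negate^ j = trans (^-congˡ j (sym (-1*x≈-x α))) (^-distrib-* (- 1#) α j)

    -- The summand of the inner sum of the theorem, with `N` standing for `n ∸ m`.
    term : ℕ → ℕ → ℕ → Carrier
    term N k j = (- 1#) ^ j / BΔ 1 1 ^ j ⟨ ^-#0 β#0 j ⟩ * ((k C j) · BΔ (N ℕ.+ j) j)

    binomialTerm-coefficient : ∀ N k (j : Fin (suc k)) →
      𝕊.binomialTerm ((- α) ◃ b) 𝟙 k j N
        ≈ (k C toℕ j) · ((- α) ^ toℕ j * (b ^ˢ toℕ j) N)
    binomialTerm-coefficient N k j = begin
      𝕊.binomialTerm ((- α) ◃ b) 𝟙 k j N
        ≡⟨ ·-coefficient (k C toℕ j) _ N ⟩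
      (k C toℕ j) · (((- α) ◃ b) ^ˢ toℕ j ⊛ 𝟙 ^ˢ (k ∸ toℕ j)) N
        ≈⟨ ×-congʳ (k C toℕ j) (begin
             (((- α) ◃ b) ^ˢ toℕ j ⊛ 𝟙 ^ˢ (k ∸ toℕ j)) N
               ≈⟨ ⊛-congˡ (((- α) ◃ b) ^ˢ toℕ j) (𝟙^ (k ∸ toℕ j)) N ⟩
             (((- α) ◃ b) ^ˢ toℕ j ⊛ 𝟙) N
               ≈⟨ 𝕊.*-identityʳ (((- α) ◃ b) ^ˢ toℕ j) N ⟩
             (((- α) ◃ b) ^ˢ toℕ j) N
               ≈⟨ ◃-^ (- α) b (toℕ j) N ⟩
             (- α) ^ toℕ j * (b ^ˢ toℕ j) N ∎) ⟩
      (k C toℕ j) · ((- α) ^ toℕ j * (b ^ˢ toℕ j) N) ∎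
      where
      𝟙^ : ∀ j → 𝟙 ^ˢ j ≋ 𝟙
      𝟙^ zero    n = refl
      𝟙^ (suc j) n = trans (⊛-identityˡ (𝟙 ^ˢ j) n) (𝟙^ j n)

    ·-zero : ∀ k {x} → x ≈ 0# → k · x ≈ 0#
    ·-zero zero    x≈0 = refl
    ·-zero (suc k) x≈0 = trans (+-cong x≈0 (·-zero k x≈0)) (+-identityˡ _)

    u^-coefficient : ∀ N k → (u ^ˢ k) (suc N) ≈ ∑[1≤ j ≤ k ] term (suc N) k j
    u^-coefficient N k = begin
      (u ^ˢ k) (suc N)
        ≈⟨ 𝕊.theorem k ((- α) ◃ b) 𝟙 (suc N) ⟩
      𝕊.sum (𝕊.binomialTerm ((- α) ◃ b) 𝟙 k) (suc N)
        ≡⟨ sum-coefficient (𝕊.binomialTerm ((- α) ◃ b) 𝟙 k) (suc N) ⟩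
      ∑[ j < suc k ] 𝕊.binomialTerm ((- α) ◃ b) 𝟙 k j (suc N)
        ≈⟨ sum-cong-≋ {suc k} (binomialTerm-coefficient (suc N) k) ⟩
      ∑[ j < suc k ] ((k C toℕ j) · ((- α) ^ toℕ j * (b ^ˢ toℕ j) (suc N)))
        -- The term `j` = 0 involves `b ^ˢ 0`, which is `𝟙` and has no coefficient in the positive
        -- degree `suc N`. Hence the inner sum starts at 1.
        ≈⟨ +-cong (·-zero (k C 0) (zeroʳ _)) (sum-cong-≋ {k} (λ j → matchTerm (suc (toℕ j)))) ⟩
      0# + (∑[1≤ j ≤ k ] term (suc N) k j)
        ≈⟨ +-identityˡ _ ⟩
      (∑[1≤ j ≤ k ] term (suc N) k j) ∎
      where
      matchTerm : ∀ j → (k C j) · ((- α) ^ j * (b ^ˢ j) (suc N)) ≈ term (suc N) k j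
      matchTerm j = begin
        (k C j) · ((- α) ^ j * (b ^ˢ j) (suc N))
          ≈⟨ ×-comm-* (k C j) _ _ ⟨
        (- α) ^ j * ((k C j) · (b ^ˢ j) (suc N))
          ≈⟨ *-cong (trans (/β^ ((- 1#) ^ j) j) (sym (negate^ j)))
                    (×-congʳ (k C j) (composita-coefficient b (suc N) j)) ⟨
        term (suc N) k j ∎

    p^-coefficient : ∀ m N → (p ^ˢ m) (suc N)
      ≈ ∑[1≤ k ≤ suc N ] (multichoose m k · (∑[1≤ j ≤ k ] term (suc N) k j))
    p^-coefficient m N = begin
      (p ^ˢ m) (suc N)
        -- The order `2 + N` is the least one whose remainder does not reach degree `suc N`.
        ≈⟨ proj₂ (𝕊.expansion {p} {u} p≋1+up m (2 ℕ.+ N)) (suc N) ⟩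
      𝕊.partialSum u m (2 ℕ.+ N) (suc N) + (u ^ˢ (2 ℕ.+ N) ⊛ q) (suc N)
        ≈⟨ +-congˡ (^-order {u} u₀≈0 (2 ℕ.+ N) q (ℕ.n<1+n (suc N))) ⟩
      𝕊.partialSum u m (2 ℕ.+ N) (suc N) + 0#
        ≈⟨ +-identityʳ _ ⟩
      𝕊.partialSum u m (2 ℕ.+ N) (suc N)
        ≡⟨ sum-coefficient {2 ℕ.+ N} (λ k → multichoose m (toℕ k) 𝕊.· u ^ˢ toℕ k) (suc N) ⟩
      ∑[ k < 2 ℕ.+ N ] ((multichoose m (toℕ k) 𝕊.· u ^ˢ toℕ k) (suc N))
        ≈⟨ sum-cong-≋ {2 ℕ.+ N} (λ k → trans
             (reflexive (·-coefficient (multichoose m (toℕ k)) (u ^ˢ toℕ k) (suc N)))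
             (×-congʳ (multichoose m (toℕ k)) (u^-coefficient N (toℕ k)))) ⟩
      ∑[ k < 2 ℕ.+ N ] (multichoose m (toℕ k) · (∑[1≤ j ≤ toℕ k ] term (suc N) (toℕ k) j))
        -- For `k` = 0 the inner sum is empty, so the outer sum starts at 1 as well.
        ≈⟨ trans (+-congʳ (·-zero (multichoose m 0) refl)) (+-identityˡ _) ⟩
      (∑[1≤ k ≤ suc N ] (multichoose m k · (∑[1≤ j ≤ k ] term (suc N) k j))) ∎
      where
      q : Series
      q = proj₁ (𝕊.expansion {p} {u} p≋1+up m (2 ℕ.+ N))

    diagonal : ∀ m → composita (shift a) m m ≈ 1# / BΔ 1 1 ^ m ⟨ ^-#0 β#0 m ⟩
    diagonal m = begin
      composita (shift a) m m               ≈⟨ composita-coefficient a 0 m ⟩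
      (a ^ˢ m) 0                            ≈⟨ ^-constant a m ⟩
      α ^ m                                 ≈⟨ *-identityˡ _ ⟨
      1# * α ^ m                            ≈⟨ /β^ 1# m ⟨
      1# / BΔ 1 1 ^ m ⟨ ^-#0 β#0 m ⟩        ∎

    -- The difference `N` is a separate variable tied to `n` by an equation: matching on the
    -- equation puts `n` in the form `composita-coefficient` expects, while `N` can still be
    -- instantiated to `n ∸ suc m`.
    offDiagonal : ∀ {n} m N → N ℕ.+ suc m ≡ n → 0 < N → composita (shift a) n (suc m)
      ≈ 1# / BΔ 1 1 ^ suc m ⟨ ^-#0 β#0 (suc m) ⟩
        * (∑[1≤ k ≤ N ] (((m ℕ.+ k) C m) · (∑[1≤ j ≤ k ] term (N) k j)))
    offDiagonal m (suc N) ≡.refl _ = begin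
      composita (shift a) (suc N ℕ.+ suc m) (suc m)
        ≈⟨ composita-coefficient a (suc N) (suc m) ⟩
      (a ^ˢ suc m) (suc N)
        ≈⟨ 𝕊.^-congˡ (suc m) a≋αp (suc N) ⟩
      ((α ◃ p) ^ˢ suc m) (suc N)
        ≈⟨ ◃-^ α p (suc m) (suc N) ⟩
      α ^ suc m * (p ^ˢ suc m) (suc N)
        ≈⟨ *-cong (trans (sym (*-identityˡ _)) (sym (/β^ 1# (suc m))))
             (trans (p^-coefficient (suc m) N)
               (sum-cong-≋ {suc N} (λ k →
                 ×-congˡ {∑[1≤ j ≤ suc (toℕ k) ] term (suc N) (suc (toℕ k)) j}
                   (≡.sym ([m+k]Cm≡[m+k]Ck m (suc (toℕ k))))))) ⟩
      1# / BΔ 1 1 ^ suc m ⟨ ^-#0 β#0 (suc m) ⟩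
        * (∑[1≤ k ≤ suc N ] (((m ℕ.+ k) C m) · (∑[1≤ j ≤ k ] term (suc N) k j))) ∎

theorem2 : ∀ {c ℓ₁ ℓ₂} (K : HeytingField c ℓ₁ ℓ₂) →
  let open HeytingField K
      open PowerSeries K
  in
  (b a : Series) (b₀#0 : b 0 # 0#) → a ⊛ b ≋ 𝟙 →
  let BΔ = composita (shift b)
      AΔ = composita (shift a)
      β#0 = composita-shift-1-1#0 b b₀#0
  in
  ∀ n m → 1 ≤ m → m ≤ n →
    (n ≡ m → AΔ n m ≈ 1# / BΔ 1 1 ^ m ⟨ ^-#0 β#0 m ⟩)
    ×
    (m < n → AΔ n m ≈
      1# / BΔ 1 1 ^ m ⟨ ^-#0 β#0 m ⟩ *
      (∑[1≤ k ≤ n ∸ m ]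
        ((m ℕ.+ k ∸ 1) C (m ∸ 1)) ·
        (∑[1≤ j ≤ k ]
          ((- 1#) ^ j / BΔ 1 1 ^ j ⟨ ^-#0 β#0 j ⟩ *
            ((k C j) · BΔ (n ∸ m ℕ.+ j) j)))))
-- With `suc m` in place of `m`, the truncated subtractions in the outer binomial coefficient
-- compute to `m + k` and `m`.
theorem2 K b a b₀#0 ab≋1 n (suc m) _ m≤n =
  (λ { ≡.refl → diagonal (suc m) }) ,
  (λ m<n → offDiagonal m (n ∸ suc m) (ℕ.m∸n+n≡m m≤n) (ℕ.m<n⇒0<n∸m m<n))
  where
  open SeriesProperties.Reciprocal K b a b₀#0 ab≋1
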